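{- Let $k \geq 2$ be an integer and let $\{F_n(k)\}_{n \geq 0}$ be any sequence of complex numbers satisfying $F_n(k) = F_{n-1}(k) + F_{n-2}(k) + \dots + F_{n-k}(k)$ for all $n \geq k$. Then for all $n \geq k$, $$F_n(k) = - F_k(k) \sum_{i=1}^{\lfloor \frac{n+1}{k+1} \rfloor} (-1)^i \binom{n-ik}{i-1} 2^{n+1-i(k+1)} + \sum_{j=0}^{k-1} \sum_{i=1}^{\lfloor \frac{n-j}{k+1} \rfloor} (-1)^i F_j(k) \binom{n-j-1-ik}{i-1} 2^{n-j-i(k+1)}.$$
   Context: Empty sums are $0$. -}

module Defs where

open import Algebra.Bundles using (CommutativeRing)
import Algebra.Properties.Monoid.Sum as MonoidSum
import Algebra.Properties.Semiring.Exp as SemiringExp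
import Algebra.Properties.Semiring.Mult as SemiringMult
open import Algebra.Structures using (IsRing)
open import Data.Fin.Base using (toℕ)
open import Data.Nat.Base as ℕ using (ℕ)
import Data.Nat.Properties as ℕₚ
open import Data.Product.Base using (∃-syntax; _×_; _,_; proj₁; proj₂)
open import Data.Rational.Base as ℚ using (ℚ; 0ℚ; 1ℚ; ½; ∣_∣)
import Data.Rational.Properties as ℚₚ
open import Level using (0ℓ)
open import Relation.Nullary.Decidable.Core using (dec⇒maybe)
open import Relation.Binary.PropositionalEquality
  using (_≡_; refl; sym; trans; cong; cong₂; subst)
open import Tactic.RingSolver using (solve-∀)
import Tactic.RingSolver.Core.AlmostCommutativeRing as TACR

-- The reals are Cauchy sequences of rationals, two of them being equal when
-- their difference tends to zero. Without quotients this equality is a setoid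
-- relation.

Eventually : (ℕ → Set) → Set
Eventually P = ∃[ N ] ∀ n → N ℕ.≤ n → P n

IsCauchy : (ℕ → ℚ) → Set
IsCauchy u = ∀ ε → 0ℚ ℚ.< ε →
  ∃[ N ] ∀ m n → N ℕ.≤ m → N ℕ.≤ n → ∣ u m ℚ.- u n ∣ ℚ.< ε

record ℝ : Set where
  constructor mkℝ
  field
    seq    : ℕ → ℚ
    cauchy : IsCauchy seq

open ℝ

infix 4 _≈ℝ_

record _≈ℝ_ (x y : ℝ) : Set where
  constructor mk≈ℝ
  field
    close : ∀ ε → 0ℚ ℚ.< ε → Eventually λ n → ∣ seq x n ℚ.- seq y n ∣ ℚ.< ε

open _≈ℝ_

private

  ℚ-ring : TACR.AlmostCommutativeRing 0ℓ 0ℓ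
  ℚ-ring = TACR.fromCommutativeRing ℚₚ.+-*-commutativeRing λ q → dec⇒maybe (0ℚ ℚₚ.≟ q)

  neg-diff : ∀ p q → ℚ.- (p ℚ.+ ℚ.- q) ≡ q ℚ.+ ℚ.- p
  neg-diff = solve-∀ ℚ-ring

  diff-neg : ∀ p q → q ℚ.+ ℚ.- p ≡ ℚ.- p ℚ.+ ℚ.- (ℚ.- q)
  diff-neg = solve-∀ ℚ-ring

  diff-+ : ∀ a b a′ b′ →
    (a ℚ.+ ℚ.- a′) ℚ.+ (b ℚ.+ ℚ.- b′) ≡ (a ℚ.+ b) ℚ.+ ℚ.- (a′ ℚ.+ b′)
  diff-+ = solve-∀ ℚ-ring

  diff-trans : ∀ a b c → (a ℚ.+ ℚ.- b) ℚ.+ (b ℚ.+ ℚ.- c) ≡ a ℚ.+ ℚ.- c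
  diff-trans = solve-∀ ℚ-ring

  diff-* : ∀ a b a′ b′ →
    a ℚ.* (b ℚ.+ ℚ.- b′) ℚ.+ b′ ℚ.* (a ℚ.+ ℚ.- a′) ≡ a ℚ.* b ℚ.+ ℚ.- (a′ ℚ.* b′)
  diff-* = solve-∀ ℚ-ring

  diff-cancel : ∀ p q → q ℚ.+ (p ℚ.+ ℚ.- q) ≡ p
  diff-cancel = solve-∀ ℚ-ring

  both : ∀ {P Q : ℕ → Set} → Eventually P → Eventually Q →
         Eventually λ n → P n × Q n
  both (M , p) (N , q) = M ℕ.⊔ N , λ n M⊔N≤n →
    p n (ℕₚ.≤-trans (ℕₚ.m≤m⊔n M N) M⊔N≤n) , q n (ℕₚ.≤-trans (ℕₚ.m≤n⊔m M N) M⊔N≤n)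

  0<½* : ∀ {ε} → 0ℚ ℚ.< ε → 0ℚ ℚ.< ½ ℚ.* ε
  0<½* {ε} 0<ε = ℚₚ.positive⁻¹ _ {{ℚₚ.pos*pos⇒pos ½ ε {{ℚ.positive 0<ε}}}}

  ½+½ : ∀ ε → ½ ℚ.* ε ℚ.+ ½ ℚ.* ε ≡ ε
  ½+½ ε = trans (sym (ℚₚ.*-distribʳ-+ ε ½ ½)) (ℚₚ.*-identityˡ ε)

  ∣+∣<ε : ∀ {p q ε} → ∣ p ∣ ℚ.< ½ ℚ.* ε → ∣ q ∣ ℚ.< ½ ℚ.* ε → ∣ p ℚ.+ q ∣ ℚ.< ε
  ∣+∣<ε {p} {q} {ε} p< q< = ℚₚ.≤-<-trans (ℚₚ.∣p+q∣≤∣p∣+∣q∣ p q)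
    (subst (∣ p ∣ ℚ.+ ∣ q ∣ ℚ.<_) (½+½ ε) (ℚₚ.+-mono-< p< q<))

  ∣p-q∣-sym : ∀ p q → ∣ p ℚ.- q ∣ ≡ ∣ q ℚ.- p ∣
  ∣p-q∣-sym p q = trans (sym (ℚₚ.∣-p∣≡∣p∣ (p ℚ.- q)))
    (cong ∣_∣ (neg-diff p q))

  +-close : ∀ a b a′ b′ {ε} →
            ∣ a ℚ.- a′ ∣ ℚ.< ½ ℚ.* ε → ∣ b ℚ.- b′ ∣ ℚ.< ½ ℚ.* ε →
            ∣ (a ℚ.+ b) ℚ.- (a′ ℚ.+ b′) ∣ ℚ.< ε
  +-close a b a′ b′ {ε} p q = subst (λ t → ∣ t ∣ ℚ.< ε)
    (diff-+ a b a′ b′)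
    (∣+∣<ε p q)

  neg-close : ∀ a a′ {ε} → ∣ a ℚ.- a′ ∣ ℚ.< ε → ∣ (ℚ.- a) ℚ.- (ℚ.- a′) ∣ ℚ.< ε
  neg-close a a′ {ε} p = subst (ℚ._< ε)
    (trans (∣p-q∣-sym a a′)
      (cong ∣_∣ (diff-neg a a′)))
    p

  trans-close : ∀ a b c {ε} →
                ∣ a ℚ.- b ∣ ℚ.< ½ ℚ.* ε → ∣ b ℚ.- c ∣ ℚ.< ½ ℚ.* ε →
                ∣ a ℚ.- c ∣ ℚ.< ε
  trans-close a b c {ε} p q = subst (λ t → ∣ t ∣ ℚ.< ε)
    (diff-trans a b c)
    (∣+∣<ε p q)

  ∣*∣< : ∀ B δ .{{_ : ℚ.Positive B}} p q →
         ∣ p ∣ ℚ.< B → ∣ q ∣ ℚ.< δ → ∣ p ℚ.* q ∣ ℚ.< B ℚ.* δ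
  ∣*∣< B δ p q p<B q<δ = begin-strict
    ∣ p ℚ.* q ∣     ≡⟨ ℚₚ.∣p*q∣≡∣p∣*∣q∣ p q ⟩
    ∣ p ∣ ℚ.* ∣ q ∣ ≤⟨ ℚₚ.*-monoʳ-≤-nonNeg ∣ q ∣ {{ℚₚ.∣-∣-nonNeg q}} (ℚₚ.<⇒≤ p<B) ⟩
    B ℚ.* ∣ q ∣     <⟨ ℚₚ.*-monoʳ-<-pos B q<δ ⟩
    B ℚ.* δ         ∎
    where open ℚₚ.≤-Reasoning

  *-close : ∀ B ε → 0ℚ ℚ.< B → 0ℚ ℚ.< ε → ∃[ δ ] 0ℚ ℚ.< δ ×
            (∀ a b a′ b′ → ∣ a ∣ ℚ.< B → ∣ b′ ∣ ℚ.< B →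
             ∣ a ℚ.- a′ ∣ ℚ.< δ → ∣ b ℚ.- b′ ∣ ℚ.< δ →
             ∣ (a ℚ.* b) ℚ.- (a′ ℚ.* b′) ∣ ℚ.< ε)
  *-close B ε 0<B 0<ε = δ , 0<δ , bound
    where
    instance
      B-pos : ℚ.Positive B
      B-pos = ℚ.positive 0<B
      B-nz : ℚ.NonZero B
      B-nz = ℚₚ.pos⇒nonZero B
    δ : ℚ
    δ = ℚ.1/ B ℚ.* (½ ℚ.* ε)
    0<δ : 0ℚ ℚ.< δ
    0<δ = ℚₚ.positive⁻¹ δ
      {{ℚₚ.pos*pos⇒pos (ℚ.1/ B) {{ℚₚ.1/pos⇒pos B}} (½ ℚ.* ε) {{ℚ.positive (0<½* 0<ε)}}}}
    Bδ : B ℚ.* δ ≡ ½ ℚ.* ε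
    Bδ = trans (sym (ℚₚ.*-assoc B (ℚ.1/ B) (½ ℚ.* ε)))
      (trans (cong (ℚ._* (½ ℚ.* ε)) (ℚₚ.*-inverseʳ B)) (ℚₚ.*-identityˡ (½ ℚ.* ε)))
    bound : ∀ a b a′ b′ → ∣ a ∣ ℚ.< B → ∣ b′ ∣ ℚ.< B →
            ∣ a ℚ.- a′ ∣ ℚ.< δ → ∣ b ℚ.- b′ ∣ ℚ.< δ →
            ∣ (a ℚ.* b) ℚ.- (a′ ℚ.* b′) ∣ ℚ.< ε
    bound a b a′ b′ a<B b′<B aa′<δ bb′<δ = subst (λ t → ∣ t ∣ ℚ.< ε)
      (diff-* a b a′ b′)
      (∣+∣<ε
        (subst (∣ a ℚ.* (b ℚ.- b′) ∣ ℚ.<_) Bδ (∣*∣< B δ a (b ℚ.- b′) a<B bb′<δ))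
        (subst (∣ b′ ℚ.* (a ℚ.- a′) ∣ ℚ.<_) Bδ (∣*∣< B δ b′ (a ℚ.- a′) b′<B aa′<δ)))

  bounded : ∀ x → ∃[ B ] 0ℚ ℚ.< B × Eventually λ n → ∣ seq x n ∣ ℚ.< B
  bounded x = ∣ seq x N ∣ ℚ.+ 1ℚ , 0<B , N , bound
    where
    N : ℕ
    N = proj₁ (cauchy x 1ℚ (ℚₚ.positive⁻¹ 1ℚ))
    c : ∀ m n → N ℕ.≤ m → N ℕ.≤ n → ∣ seq x m ℚ.- seq x n ∣ ℚ.< 1ℚ
    c = proj₂ (cauchy x 1ℚ (ℚₚ.positive⁻¹ 1ℚ))
    0<B : 0ℚ ℚ.< ∣ seq x N ∣ ℚ.+ 1ℚ
    0<B = ℚₚ.+-mono-≤-< {0ℚ} {∣ seq x N ∣} {0ℚ} {1ℚ} (ℚₚ.0≤∣p∣ (seq x N)) (ℚₚ.positive⁻¹ 1ℚ)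
    bound : ∀ n → N ℕ.≤ n → ∣ seq x n ∣ ℚ.< ∣ seq x N ∣ ℚ.+ 1ℚ
    bound n N≤n = subst (λ t → ∣ t ∣ ℚ.< ∣ seq x N ∣ ℚ.+ 1ℚ)
      (diff-cancel (seq x n) (seq x N))
      (ℚₚ.≤-<-trans (ℚₚ.∣p+q∣≤∣p∣+∣q∣ (seq x N) (seq x n ℚ.- seq x N))
        (ℚₚ.+-monoʳ-< ∣ seq x N ∣ {∣ seq x n ℚ.- seq x N ∣} {1ℚ} (c n N N≤n ℕₚ.≤-refl)))

  bounded₂ : ∀ x y → ∃[ B ] 0ℚ ℚ.< B ×
             Eventually λ n → ∣ seq x n ∣ ℚ.< B × ∣ seq y n ∣ ℚ.< B
  bounded₂ x y =
    let (B , 0<B , b) = bounded x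
        (C , 0<C , c) = bounded y
        (N , d) = both b c
    in B ℚ.⊔ C , ℚₚ.<-≤-trans 0<B (ℚₚ.p≤p⊔q B C) , N , λ n N≤n →
      ℚₚ.<-≤-trans (proj₁ (d n N≤n)) (ℚₚ.p≤p⊔q B C) ,
      ℚₚ.<-≤-trans (proj₂ (d n N≤n)) (ℚₚ.p≤q⊔p B C)

-- The Cauchy proofs are abstract so that conversion checking never unfolds them.
private abstract
  const-isCauchy : ∀ q → IsCauchy (λ _ → q)
  const-isCauchy q ε 0<ε = 0 , λ _ _ _ _ →
    subst (λ t → ∣ t ∣ ℚ.< ε) (sym (ℚₚ.+-inverseʳ q)) 0<ε

constℝ : ℚ → ℝ
constℝ q = mkℝ (λ _ → q) (const-isCauchy q)

0ℝ 1ℝ : ℝ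
0ℝ = constℝ 0ℚ
1ℝ = constℝ 1ℚ

infixl 6 _+ℝ_
infixl 7 _*ℝ_
infix  8 -ℝ_

private abstract
  +-isCauchy : ∀ x y → IsCauchy (λ n → seq x n ℚ.+ seq y n)
  +-isCauchy x y ε 0<ε =
    let (M , p) = cauchy x (½ ℚ.* ε) (0<½* 0<ε)
        (N , q) = cauchy y (½ ℚ.* ε) (0<½* 0<ε)
    in M ℕ.⊔ N , λ m n m≥ n≥ →
    +-close (seq x m) (seq y m) (seq x n) (seq y n)
      (p m n (ℕₚ.≤-trans (ℕₚ.m≤m⊔n M N) m≥) (ℕₚ.≤-trans (ℕₚ.m≤m⊔n M N) n≥))
      (q m n (ℕₚ.≤-trans (ℕₚ.m≤n⊔m M N) m≥) (ℕₚ.≤-trans (ℕₚ.m≤n⊔m M N) n≥))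

_+ℝ_ : ℝ → ℝ → ℝ
x +ℝ y = mkℝ (λ n → seq x n ℚ.+ seq y n) (+-isCauchy x y)

private abstract
  neg-isCauchy : ∀ x → IsCauchy (λ n → ℚ.- seq x n)
  neg-isCauchy x ε 0<ε =
    let (N , p) = cauchy x ε 0<ε
    in N , λ m n m≥ n≥ → neg-close (seq x m) (seq x n) (p m n m≥ n≥)

-ℝ_ : ℝ → ℝ
-ℝ x = mkℝ (λ n → ℚ.- seq x n) (neg-isCauchy x)

private abstract
  *-isCauchy : ∀ x y → IsCauchy (λ n → seq x n ℚ.* seq y n)
  *-isCauchy x y ε 0<ε =
    let (B , 0<B , K , b) = bounded₂ x y
        (δ , 0<δ , close*) = *-close B ε 0<B 0<ε
        (M , p) = cauchy x δ 0<δ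
        (N , q) = cauchy y δ 0<δ
        L = M ℕ.⊔ N
        M≤ = λ {n} (h : K ℕ.⊔ L ℕ.≤ n) → ℕₚ.≤-trans (ℕₚ.m≤m⊔n M N) (ℕₚ.≤-trans (ℕₚ.m≤n⊔m K L) h)
        N≤ = λ {n} (h : K ℕ.⊔ L ℕ.≤ n) → ℕₚ.≤-trans (ℕₚ.m≤n⊔m M N) (ℕₚ.≤-trans (ℕₚ.m≤n⊔m K L) h)
    in K ℕ.⊔ L , λ m n m≥ n≥ →
      close* (seq x m) (seq y m) (seq x n) (seq y n)
        (proj₁ (b m (ℕₚ.≤-trans (ℕₚ.m≤m⊔n K L) m≥)))
        (proj₂ (b n (ℕₚ.≤-trans (ℕₚ.m≤m⊔n K L) n≥)))
        (p m n (M≤ m≥) (M≤ n≥)) (q m n (N≤ m≥) (N≤ n≥))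

_*ℝ_ : ℝ → ℝ → ℝ
x *ℝ y = mkℝ (λ n → seq x n ℚ.* seq y n) (*-isCauchy x y)

private

  pointwise : ∀ {x y} → (∀ n → seq x n ≡ seq y n) → x ≈ℝ y
  pointwise {x} {y} eq .close ε 0<ε = 0 , λ n _ →
    subst (λ t → ∣ t ∣ ℚ.< ε)
      (sym (trans (cong (ℚ._- seq y n) (eq n)) (ℚₚ.+-inverseʳ (seq y n)))) 0<ε

  ≈ℝ-sym : ∀ {x y} → x ≈ℝ y → y ≈ℝ x
  ≈ℝ-sym {x} {y} x≈y .close ε 0<ε =
    let (N , p) = x≈y .close ε 0<ε
    in N , λ n n≥ → subst (ℚ._< ε) (∣p-q∣-sym (seq x n) (seq y n)) (p n n≥)

  ≈ℝ-trans : ∀ {x y z} → x ≈ℝ y → y ≈ℝ z → x ≈ℝ z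
  ≈ℝ-trans {x} {y} {z} x≈y y≈z .close ε 0<ε =
    let (N , p) = both (x≈y .close (½ ℚ.* ε) (0<½* 0<ε)) (y≈z .close (½ ℚ.* ε) (0<½* 0<ε))
    in N , λ n n≥ →
    trans-close (seq x n) (seq y n) (seq z n) (proj₁ (p n n≥)) (proj₂ (p n n≥))

  +ℝ-cong : ∀ {x x′ y y′} → x ≈ℝ x′ → y ≈ℝ y′ → x +ℝ y ≈ℝ x′ +ℝ y′
  +ℝ-cong {x} {x′} {y} {y′} x≈ y≈ .close ε 0<ε =
    let (N , p) = both (x≈ .close (½ ℚ.* ε) (0<½* 0<ε)) (y≈ .close (½ ℚ.* ε) (0<½* 0<ε))
    in N , λ n n≥ →
    +-close (seq x n) (seq y n) (seq x′ n) (seq y′ n) (proj₁ (p n n≥)) (proj₂ (p n n≥))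

  -ℝ-cong : ∀ {x x′} → x ≈ℝ x′ → -ℝ x ≈ℝ -ℝ x′
  -ℝ-cong {x} {x′} x≈ .close ε 0<ε =
    let (N , p) = x≈ .close ε 0<ε
    in N , λ n n≥ → neg-close (seq x n) (seq x′ n) (p n n≥)

  *ℝ-cong : ∀ {x x′ y y′} → x ≈ℝ x′ → y ≈ℝ y′ → x *ℝ y ≈ℝ x′ *ℝ y′
  *ℝ-cong {x} {x′} {y} {y′} x≈ y≈ .close ε 0<ε =
    let (B , 0<B , b) = bounded₂ x y′
        (δ , 0<δ , close*) = *-close B ε 0<B 0<ε
        (N , p) = both b (both (x≈ .close δ 0<δ) (y≈ .close δ 0<δ))
    in N , λ n n≥ →
    let ((x< , y′<) , (xx′ , yy′)) = p n n≥
    in close* (seq x n) (seq y n) (seq x′ n) (seq y′ n) x< y′< xx′ yy′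

  ≈ℝ-refl : ∀ {x} → x ≈ℝ x
  ≈ℝ-refl = pointwise λ _ → refl

  +ℝ-assoc : ∀ x y z → (x +ℝ y) +ℝ z ≈ℝ x +ℝ (y +ℝ z)
  +ℝ-assoc x y z = pointwise λ n → ℚₚ.+-assoc (seq x n) (seq y n) (seq z n)

  +ℝ-comm : ∀ x y → x +ℝ y ≈ℝ y +ℝ x
  +ℝ-comm x y = pointwise λ n → ℚₚ.+-comm (seq x n) (seq y n)

  +ℝ-identityˡ : ∀ x → 0ℝ +ℝ x ≈ℝ x
  +ℝ-identityˡ x = pointwise λ n → ℚₚ.+-identityˡ (seq x n)

  +ℝ-identityʳ : ∀ x → x +ℝ 0ℝ ≈ℝ x
  +ℝ-identityʳ x = pointwise λ n → ℚₚ.+-identityʳ (seq x n)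

  +ℝ-inverseˡ : ∀ x → -ℝ x +ℝ x ≈ℝ 0ℝ
  +ℝ-inverseˡ x = pointwise λ n → ℚₚ.+-inverseˡ (seq x n)

  +ℝ-inverseʳ : ∀ x → x +ℝ -ℝ x ≈ℝ 0ℝ
  +ℝ-inverseʳ x = pointwise λ n → ℚₚ.+-inverseʳ (seq x n)

  *ℝ-assoc : ∀ x y z → (x *ℝ y) *ℝ z ≈ℝ x *ℝ (y *ℝ z)
  *ℝ-assoc x y z = pointwise λ n → ℚₚ.*-assoc (seq x n) (seq y n) (seq z n)

  *ℝ-comm : ∀ x y → x *ℝ y ≈ℝ y *ℝ x
  *ℝ-comm x y = pointwise λ n → ℚₚ.*-comm (seq x n) (seq y n)

  *ℝ-identityˡ : ∀ x → 1ℝ *ℝ x ≈ℝ x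
  *ℝ-identityˡ x = pointwise λ n → ℚₚ.*-identityˡ (seq x n)

  *ℝ-identityʳ : ∀ x → x *ℝ 1ℝ ≈ℝ x
  *ℝ-identityʳ x = pointwise λ n → ℚₚ.*-identityʳ (seq x n)

  *ℝ-distribˡ-+ℝ : ∀ x y z → x *ℝ (y +ℝ z) ≈ℝ x *ℝ y +ℝ x *ℝ z
  *ℝ-distribˡ-+ℝ x y z = pointwise λ n → ℚₚ.*-distribˡ-+ (seq x n) (seq y n) (seq z n)

  *ℝ-distribʳ-+ℝ : ∀ x y z → (y +ℝ z) *ℝ x ≈ℝ y *ℝ x +ℝ z *ℝ x
  *ℝ-distribʳ-+ℝ x y z = pointwise λ n → ℚₚ.*-distribʳ-+ (seq x n) (seq y n) (seq z n)

  ℝ-isRing : IsRing _≈ℝ_ _+ℝ_ _*ℝ_ -ℝ_ 0ℝ 1ℝ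
  ℝ-isRing = record
    { +-isAbelianGroup = record
      { isGroup = record
        { isMonoid = record
          { isSemigroup = record
            { isMagma = record
              { isEquivalence = record { refl = ≈ℝ-refl ; sym = ≈ℝ-sym ; trans = ≈ℝ-trans }
              ; ∙-cong = +ℝ-cong
              }
            ; assoc = +ℝ-assoc
            }
          ; identity = +ℝ-identityˡ , +ℝ-identityʳ
          }
        ; inverse = +ℝ-inverseˡ , +ℝ-inverseʳ
        ; ⁻¹-cong = -ℝ-cong
        }
      ; comm = +ℝ-comm
      }
    ; *-cong = *ℝ-cong
    ; *-assoc = *ℝ-assoc
    ; *-identity = *ℝ-identityˡ , *ℝ-identityʳ
    ; distrib = *ℝ-distribˡ-+ℝ , *ℝ-distribʳ-+ℝ
    }

ℝ-commutativeRing : CommutativeRing 0ℓ 0ℓ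
ℝ-commutativeRing = record
  { isCommutativeRing = record { isRing = ℝ-isRing ; *-comm = *ℝ-comm } }

infix 8 _+i_

record ℂ : Set where
  constructor _+i_
  field
    re im : ℝ

open ℂ

infix 4 _≈ℂ_

record _≈ℂ_ (z w : ℂ) : Set where
  constructor mk≈ℂ
  field
    re≈ : re z ≈ℝ re w
    im≈ : im z ≈ℝ im w

infixl 6 _+ℂ_
infixl 7 _*ℂ_
infix  8 -ℂ_

0ℂ 1ℂ : ℂ
0ℂ = 0ℝ +i 0ℝ
1ℂ = 1ℝ +i 0ℝ

_+ℂ_ _*ℂ_ : ℂ → ℂ → ℂ
(a +i b) +ℂ (c +i d) = (a +ℝ c) +i (b +ℝ d)
(a +i b) *ℂ (c +i d) = (a *ℝ c +ℝ -ℝ (b *ℝ d)) +i (a *ℝ d +ℝ b *ℝ c)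

-ℂ_ : ℂ → ℂ
-ℂ (a +i b) = (-ℝ a) +i (-ℝ b)

private
  assoc-re : ∀ a b c d e f →
    (a ℚ.* c ℚ.+ ℚ.- (b ℚ.* d)) ℚ.* e ℚ.+ ℚ.- ((a ℚ.* d ℚ.+ b ℚ.* c) ℚ.* f) ≡
    a ℚ.* (c ℚ.* e ℚ.+ ℚ.- (d ℚ.* f)) ℚ.+ ℚ.- (b ℚ.* (c ℚ.* f ℚ.+ d ℚ.* e))
  assoc-re = solve-∀ ℚ-ring

  assoc-im : ∀ a b c d e f →
    (a ℚ.* c ℚ.+ ℚ.- (b ℚ.* d)) ℚ.* f ℚ.+ (a ℚ.* d ℚ.+ b ℚ.* c) ℚ.* e ≡
    a ℚ.* (c ℚ.* f ℚ.+ d ℚ.* e) ℚ.+ b ℚ.* (c ℚ.* e ℚ.+ ℚ.- (d ℚ.* f))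
  assoc-im = solve-∀ ℚ-ring

  distrib-re : ∀ a b c d e f →
    a ℚ.* (c ℚ.+ e) ℚ.+ ℚ.- (b ℚ.* (d ℚ.+ f)) ≡
    (a ℚ.* c ℚ.+ ℚ.- (b ℚ.* d)) ℚ.+ (a ℚ.* e ℚ.+ ℚ.- (b ℚ.* f))
  distrib-re = solve-∀ ℚ-ring

  distrib-im : ∀ a b c d e f →
    a ℚ.* (d ℚ.+ f) ℚ.+ b ℚ.* (c ℚ.+ e) ≡
    (a ℚ.* d ℚ.+ b ℚ.* c) ℚ.+ (a ℚ.* f ℚ.+ b ℚ.* e)
  distrib-im = solve-∀ ℚ-ring

  identity-re : ∀ a b → 1ℚ ℚ.* a ℚ.+ ℚ.- (0ℚ ℚ.* b) ≡ a
  identity-re a b = trans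
    (cong₂ (λ s t → s ℚ.+ ℚ.- t) (ℚₚ.*-identityˡ a) (ℚₚ.*-zeroˡ b)) (ℚₚ.+-identityʳ a)

  identity-im : ∀ a b → 1ℚ ℚ.* b ℚ.+ 0ℚ ℚ.* a ≡ b
  identity-im a b = trans
    (cong₂ ℚ._+_ (ℚₚ.*-identityˡ b) (ℚₚ.*-zeroˡ a)) (ℚₚ.+-identityʳ b)

  comm-re : ∀ a b c d →
    a ℚ.* c ℚ.+ ℚ.- (b ℚ.* d) ≡ c ℚ.* a ℚ.+ ℚ.- (d ℚ.* b)
  comm-re = solve-∀ ℚ-ring

  comm-im : ∀ a b c d → a ℚ.* d ℚ.+ b ℚ.* c ≡ c ℚ.* b ℚ.+ d ℚ.* a
  comm-im = solve-∀ ℚ-ring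

  ≈ℂ-refl : ∀ {x} → x ≈ℂ x
  ≈ℂ-refl = mk≈ℂ ≈ℝ-refl ≈ℝ-refl

  ≈ℂ-sym : ∀ {x y} → x ≈ℂ y → y ≈ℂ x
  ≈ℂ-sym (mk≈ℂ p q) = mk≈ℂ (≈ℝ-sym p) (≈ℝ-sym q)

  ≈ℂ-trans : ∀ {x y z} → x ≈ℂ y → y ≈ℂ z → x ≈ℂ z
  ≈ℂ-trans (mk≈ℂ p q) (mk≈ℂ r s) = mk≈ℂ (≈ℝ-trans p r) (≈ℝ-trans q s)

  +ℂ-cong : ∀ {x x′ y y′} → x ≈ℂ x′ → y ≈ℂ y′ → x +ℂ y ≈ℂ x′ +ℂ y′
  +ℂ-cong (mk≈ℂ p q) (mk≈ℂ r s) = mk≈ℂ (+ℝ-cong p r) (+ℝ-cong q s)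

  -ℂ-cong : ∀ {x x′} → x ≈ℂ x′ → -ℂ x ≈ℂ -ℂ x′
  -ℂ-cong (mk≈ℂ p q) = mk≈ℂ (-ℝ-cong p) (-ℝ-cong q)

  *ℂ-cong : ∀ {x x′ y y′} → x ≈ℂ x′ → y ≈ℂ y′ → x *ℂ y ≈ℂ x′ *ℂ y′
  *ℂ-cong (mk≈ℂ p q) (mk≈ℂ r s) = mk≈ℂ
    (+ℝ-cong (*ℝ-cong p r) (-ℝ-cong (*ℝ-cong q s)))
    (+ℝ-cong (*ℝ-cong p s) (*ℝ-cong q r))

  +ℂ-assoc : ∀ x y z → (x +ℂ y) +ℂ z ≈ℂ x +ℂ (y +ℂ z)
  +ℂ-assoc (a +i b) (c +i d) (e +i f) = mk≈ℂ (+ℝ-assoc a c e) (+ℝ-assoc b d f)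

  +ℂ-comm : ∀ x y → x +ℂ y ≈ℂ y +ℂ x
  +ℂ-comm (a +i b) (c +i d) = mk≈ℂ (+ℝ-comm a c) (+ℝ-comm b d)

  +ℂ-identityˡ : ∀ x → 0ℂ +ℂ x ≈ℂ x
  +ℂ-identityˡ (a +i b) = mk≈ℂ (+ℝ-identityˡ a) (+ℝ-identityˡ b)

  +ℂ-identityʳ : ∀ x → x +ℂ 0ℂ ≈ℂ x
  +ℂ-identityʳ (a +i b) = mk≈ℂ (+ℝ-identityʳ a) (+ℝ-identityʳ b)

  +ℂ-inverseˡ : ∀ x → -ℂ x +ℂ x ≈ℂ 0ℂ
  +ℂ-inverseˡ (a +i b) = mk≈ℂ (+ℝ-inverseˡ a) (+ℝ-inverseˡ b)

  +ℂ-inverseʳ : ∀ x → x +ℂ -ℂ x ≈ℂ 0ℂ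
  +ℂ-inverseʳ (a +i b) = mk≈ℂ (+ℝ-inverseʳ a) (+ℝ-inverseʳ b)

  *ℂ-assoc : ∀ x y z → (x *ℂ y) *ℂ z ≈ℂ x *ℂ (y *ℂ z)
  *ℂ-assoc (a +i b) (c +i d) (e +i f) = mk≈ℂ
    (pointwise λ n → assoc-re (seq a n) (seq b n) (seq c n) (seq d n) (seq e n) (seq f n))
    (pointwise λ n → assoc-im (seq a n) (seq b n) (seq c n) (seq d n) (seq e n) (seq f n))

  *ℂ-comm : ∀ x y → x *ℂ y ≈ℂ y *ℂ x
  *ℂ-comm (a +i b) (c +i d) = mk≈ℂ
    (pointwise λ n → comm-re (seq a n) (seq b n) (seq c n) (seq d n))
    (pointwise λ n → comm-im (seq a n) (seq b n) (seq c n) (seq d n))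

  *ℂ-identityˡ : ∀ x → 1ℂ *ℂ x ≈ℂ x
  *ℂ-identityˡ (a +i b) = mk≈ℂ
    (pointwise λ n → identity-re (seq a n) (seq b n))
    (pointwise λ n → identity-im (seq a n) (seq b n))

  *ℂ-identityʳ : ∀ x → x *ℂ 1ℂ ≈ℂ x
  *ℂ-identityʳ x = ≈ℂ-trans (*ℂ-comm x 1ℂ) (*ℂ-identityˡ x)

  *ℂ-distribˡ-+ℂ : ∀ x y z → x *ℂ (y +ℂ z) ≈ℂ x *ℂ y +ℂ x *ℂ z
  *ℂ-distribˡ-+ℂ (a +i b) (c +i d) (e +i f) = mk≈ℂ
    (pointwise λ n → distrib-re (seq a n) (seq b n) (seq c n) (seq d n) (seq e n) (seq f n))
    (pointwise λ n → distrib-im (seq a n) (seq b n) (seq c n) (seq d n) (seq e n) (seq f n))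

  *ℂ-distribʳ-+ℂ : ∀ x y z → (y +ℂ z) *ℂ x ≈ℂ y *ℂ x +ℂ z *ℂ x
  *ℂ-distribʳ-+ℂ x y z =
    ≈ℂ-trans (*ℂ-comm (y +ℂ z) x)
      (≈ℂ-trans (*ℂ-distribˡ-+ℂ x y z) (+ℂ-cong (*ℂ-comm x y) (*ℂ-comm x z)))

  ℂ-isRing : IsRing _≈ℂ_ _+ℂ_ _*ℂ_ -ℂ_ 0ℂ 1ℂ
  ℂ-isRing = record
    { +-isAbelianGroup = record
      { isGroup = record
        { isMonoid = record
          { isSemigroup = record
            { isMagma = record
              { isEquivalence = record { refl = ≈ℂ-refl ; sym = ≈ℂ-sym ; trans = ≈ℂ-trans }
              ; ∙-cong = +ℂ-cong
              }
            ; assoc = +ℂ-assoc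
            }
          ; identity = +ℂ-identityˡ , +ℂ-identityʳ
          }
        ; inverse = +ℂ-inverseˡ , +ℂ-inverseʳ
        ; ⁻¹-cong = -ℂ-cong
        }
      ; comm = +ℂ-comm
      }
    ; *-cong = *ℂ-cong
    ; *-assoc = *ℂ-assoc
    ; *-identity = *ℂ-identityˡ , *ℂ-identityʳ
    ; distrib = *ℂ-distribˡ-+ℂ , *ℂ-distribʳ-+ℂ
    }

ℂ-commutativeRing : CommutativeRing 0ℓ 0ℓ
ℂ-commutativeRing = record
  { isCommutativeRing = record { isRing = ℂ-isRing ; *-comm = *ℂ-comm } }

module RingNotation {c ℓ} (A : CommutativeRing c ℓ) where
  open CommutativeRing A
  open MonoidSum +-monoid using (sum)
  open SemiringExp semiring public using (_^_)
  open SemiringMult semiring using () renaming (_×_ to _·_)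

  fromℕ : ℕ → Carrier
  fromℕ n = n · 1#

  infixl 6.5 ∑-syntax

  -- The sum has b + 1 - a terms, hence is empty when b < a.
  ∑-syntax : ℕ → ℕ → (ℕ → Carrier) → Carrier
  ∑-syntax a b f = sum {ℕ.suc b ℕ.∸ a} λ i → f (a ℕ.+ toℕ i)

  syntax ∑-syntax a b (λ i → e) = ∑[ a ≤ i ≤ b ] e

-- Subtracting consecutive instances of the recurrence gives F (n + 1) + F (n − k) = 2 F n for
-- n ≥ k. The inner sums of the formula are the coefficients a m of −x^d / (1 − 2x + x^d),
-- d = k + 1, expanded as the geometric series ∑ (−1)^i (x^d / (1 − 2x))^i over i ≥ 1; Pascal's
-- rule yields a (d + r) + b r = 2 a (k + r), where b m = a m + [m = 0]. Hence both sides of the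
-- formula obey the same recurrence, and they agree at n = k.
module Submission where

open import Defs
open import Algebra.Bundles using (CommutativeRing)
import Algebra.Properties.Ring as RingProperties
import Algebra.Properties.Semiring.Mult as SemiringMult
import Algebra.Properties.Semiring.Sum as SemiringSum
import Algebra.Solver.Ring.NaturalCoefficients.Default as NaturalSolver
open import Data.Fin.Base using (toℕ)
import Data.Fin.Properties as Finₚ
open import Data.Nat.Base as ℕ using (ℕ; zero; suc; _∸_; _≤_; _<_; z≤n; s≤s; _/_)
open import Data.Nat.Combinatorics using (_C_; nCn≡1; nCk+nC[k+1]≡[n+1]C[k+1])
open import Data.Nat.DivMod using (m/n*n≤m; m/n≤m; m≡m%n+[m/n]*n; m%n<n)
import Data.Nat.Properties as ℕₚ
open import Data.Nat.Tactic.RingSolver using (solve-∀)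
open import Data.Product.Base using (_,_)
open import Data.Sum.Base using (inj₁; inj₂)
import Relation.Binary.PropositionalEquality as ≡
open ≡ using (_≡_)
import Relation.Binary.Reasoning.Setoid as SetoidReasoning

module _ {ρ ℓ} (R : CommutativeRing ρ ℓ) where

  open CommutativeRing R
  open RingNotation R using (fromℕ; _^_; ∑-syntax)
  open RingProperties ring using (-1*x≈-x; +-cancelʳ)
  open SemiringSum semiring
    using (sum; sum-cong-≋; sum-init-last; sum-replicate-zero; ∑-distrib-+; *-distribˡ-sum)
  open SemiringMult semiring using (×-homo-+)
  open NaturalSolver commutativeSemiring using (solve; _:=_; _:+_; _:*_; con)
  open SetoidReasoning setoid

  -- Finite sums in a commutative ring.

  Σ< : ℕ → (ℕ → Carrier) → Carrier
  Σ< n f = sum {n} λ i → f (toℕ i)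

  Σ<-cong : ∀ n {f g} → (∀ i → i < n → f i ≈ g i) → Σ< n f ≈ Σ< n g
  Σ<-cong n eq = sum-cong-≋ λ i → eq (toℕ i) (Finₚ.toℕ<n i)

  Σ<-zero : ∀ n {f} → (∀ i → i < n → f i ≈ 0#) → Σ< n f ≈ 0#
  Σ<-zero n eq = trans (Σ<-cong n eq) (sum-replicate-zero n)

  Σ<-+ : ∀ n f g → Σ< n (λ i → f i + g i) ≈ Σ< n f + Σ< n g
  Σ<-+ n f g = ∑-distrib-+ {n} (λ i → f (toℕ i)) (λ i → g (toℕ i))

  Σ<-suc : ∀ n f → Σ< (suc n) f ≈ Σ< n f + f n
  Σ<-suc n f = trans (sum-init-last {n} λ i → f (toℕ i))
    (+-cong (sum-cong-≋ {n} λ i → reflexive (≡.cong f (Finₚ.toℕ-inject₁ i)))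
            (reflexive (≡.cong f (Finₚ.toℕ-fromℕ n))))

  Σ<-extend : ∀ {m n} f → m ≤ n → (∀ i → m ≤ i → f i ≈ 0#) → Σ< m f ≈ Σ< n f
  Σ<-extend {zero}  {n}     f _         f≈0 = sym (Σ<-zero n λ i _ → f≈0 i z≤n)
  Σ<-extend {suc m} {suc n} f (s≤s m≤n) f≈0 =
    +-congˡ (Σ<-extend (λ i → f (suc i)) m≤n λ i m≤i → f≈0 (suc i) (s≤s m≤i))

  -1*x+x≈0 : ∀ x → - 1# * x + x ≈ 0#
  -1*x+x≈0 x = trans (+-congʳ (-1*x≈-x x)) (-‿inverseˡ x)

  fromℕ-+ : ∀ m n → fromℕ (m ℕ.+ n) ≈ fromℕ m + fromℕ n
  fromℕ-+ = ×-homo-+ 1#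

  -- Power series as coefficient functions.

  -- Multiplication of a power series by x^d.
  shift : ℕ → (ℕ → Carrier) → ℕ → Carrier
  shift zero    f n       = f n
  shift (suc d) f zero    = 0#
  shift (suc d) f (suc n) = shift d f n

  shift-+ : ∀ d f n → shift d f (d ℕ.+ n) ≡ f n
  shift-+ zero    f n = ≡.refl
  shift-+ (suc d) f n = shift-+ d f n

  shift-+-+ : ∀ d c f n → shift (d ℕ.+ c) f (d ℕ.+ n) ≡ shift c f n
  shift-+-+ zero    c f n = ≡.refl
  shift-+-+ (suc d) c f n = shift-+-+ d c f n

  shift-< : ∀ {d n} f → n < d → shift d f n ≡ 0#
  shift-< {suc d} {zero}  f _         = ≡.refl
  shift-< {suc d} {suc n} f (s≤s n<d) = shift-< f n<d

  shift-cong : ∀ d {f g} n → (∀ i → i ≤ n → f i ≈ g i) → shift d f n ≈ shift d g n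
  shift-cong zero    n       eq = eq n ℕₚ.≤-refl
  shift-cong (suc d) zero    eq = refl
  shift-cong (suc d) (suc n) eq = shift-cong d n λ i i≤n → eq i (ℕₚ.m≤n⇒m≤1+n i≤n)

  impulse : ℕ → Carrier
  impulse zero    = 1#
  impulse (suc n) = 0#

  -- `shift j impulse` is the monomial x^j, so only the summand j = r survives.
  Σ<-impulse : ∀ {n r} f → r < n → Σ< n (λ j → f j * shift j impulse r) ≈ f r
  Σ<-impulse {suc n} {zero} f _ = begin
    f 0 * 1# + Σ< n (λ j → f (suc j) * 0#) ≈⟨ +-cong (*-identityʳ _) (Σ<-zero n λ j _ → zeroʳ (f (suc j))) ⟩
    f 0 + 0#                               ≈⟨ +-identityʳ _ ⟩
    f 0                                    ∎
  Σ<-impulse {suc n} {suc r} f (s≤s r<n) = begin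
    f 0 * 0# + Σ< n (λ j → f (suc j) * shift j impulse r)
      ≈⟨ +-cong (zeroʳ _) (Σ<-impulse (λ j → f (suc j)) r<n) ⟩
    0# + f (suc r) ≈⟨ +-identityˡ _ ⟩
    f (suc r)      ∎

  -- Coefficients of powers of -1 / (1 - 2x).

  -- The coefficients of (−1)^i / (1 − 2x)^i.
  coeff : ℕ → ℕ → Carrier
  coeff zero    e = impulse e
  coeff (suc p) e = (- 1#) ^ suc p * fromℕ ((e ℕ.+ p) C p) * fromℕ 2 ^ e

  coeff-0 : ∀ i → coeff i 0 ≈ (- 1#) ^ i
  coeff-0 zero    = refl
  coeff-0 (suc p) rewrite nCn≡1 p =
    trans (*-identityʳ _) (trans (*-congˡ (+-identityʳ 1#)) (*-identityʳ _))

  -- Multiplying power i + 1 of -1 / (1 - 2x) by 1 - 2x gives minus power i. Pascal's rule splits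
  -- the binomial in two; one part cancels against `coeff i` by the sign, the other is the
  -- right-hand side.
  coeff-suc : ∀ i e → coeff (suc i) (suc e) + coeff i (suc e) ≈ coeff (suc i) e + coeff (suc i) e
  coeff-suc zero e =
    solve 2 (λ s q → s :* (con 1 :+ con 0) :* ((con 1 :+ (con 1 :+ con 0)) :* q) :+ con 0 :=
                     s :* (con 1 :+ con 0) :* q :+ s :* (con 1 :+ con 0) :* q)
      refl ((- 1#) ^ 1) (fromℕ 2 ^ e)
  coeff-suc (suc p) e = begin
    - 1# * s * fromℕ ((suc e ℕ.+ suc p) C suc p) * (fromℕ 2 * q) + s * fromℕ (suc (e ℕ.+ p) C p) * (fromℕ 2 * q)
      ≈⟨ +-cong (*-congʳ (*-congˡ pascal))
           (*-congʳ (*-congˡ (reflexive (≡.cong (λ n → fromℕ (n C p)) (≡.sym (ℕₚ.+-suc e p)))))) ⟩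
    - 1# * s * (c₁ + c₂) * (fromℕ 2 * q) + s * c₁ * (fromℕ 2 * q)
      -- The semiring solver treats `- 1#` as an atom `x`, so the pair that cancels is only grouped
      -- here.
      ≈⟨ solve 5 (λ x s c₁ c₂ q → let two = con 1 :+ (con 1 :+ con 0) in
           x :* s :* (c₁ :+ c₂) :* (two :* q) :+ s :* c₁ :* (two :* q) :=
           (x :* (s :* c₁ :* (two :* q)) :+ s :* c₁ :* (two :* q)) :+ (x :* s :* c₂ :* q :+ x :* s :* c₂ :* q))
         refl (- 1#) s c₁ c₂ q ⟩
    (- 1# * (s * c₁ * (fromℕ 2 * q)) + s * c₁ * (fromℕ 2 * q)) + (- 1# * s * c₂ * q + - 1# * s * c₂ * q)
      ≈⟨ +-congʳ (-1*x+x≈0 _) ⟩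
    0# + (- 1# * s * c₂ * q + - 1# * s * c₂ * q)
      ≈⟨ +-identityˡ _ ⟩
    - 1# * s * c₂ * q + - 1# * s * c₂ * q ∎
    where
    s = (- 1#) ^ suc p
    q = fromℕ 2 ^ e
    c₁ = fromℕ ((e ℕ.+ suc p) C p)
    c₂ = fromℕ ((e ℕ.+ suc p) C suc p)
    pascal : fromℕ ((suc e ℕ.+ suc p) C suc p) ≈ c₁ + c₂
    pascal = trans (reflexive (≡.cong fromℕ (≡.sym (nCk+nC[k+1]≡[n+1]C[k+1] (e ℕ.+ suc p) p))))
      (fromℕ-+ ((e ℕ.+ suc p) C p) ((e ℕ.+ suc p) C suc p))

  -- The identity of `coeff-suc` multiplied by x^c; the extra shift on the right is the x of 2x. In
  -- degree c, where the right-hand side is 0, the leading signs (-1)^(i+1) and (-1)^i cancel.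
  shift-coeff : ∀ i c r →
    shift c (coeff (suc i)) r + shift c (coeff i) r ≈
    shift (suc c) (coeff (suc i)) r + shift (suc c) (coeff (suc i)) r
  shift-coeff i zero zero = begin
    coeff (suc i) 0 + coeff i 0      ≈⟨ +-cong (coeff-0 (suc i)) (coeff-0 i) ⟩
    - 1# * (- 1#) ^ i + (- 1#) ^ i   ≈⟨ -1*x+x≈0 _ ⟩
    0#                               ≈⟨ +-identityˡ 0# ⟨
    0# + 0#                          ∎
  shift-coeff i zero    (suc e) = coeff-suc i e
  shift-coeff i (suc c) zero    = refl
  shift-coeff i (suc c) (suc r) = shift-coeff i c r

  -- The geometric series and its recurrence.

  module _ (k : ℕ) where

    -- The coefficients of T^i, where T = -x^d / (1 - 2x) and d = k + 1.
    term : ℕ → ℕ → Carrier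
    term i = shift (i ℕ.* suc k) (coeff i)

    -- This is (1 - 2x) T^(i+1) = -x^d T^i, read in degree d + r.
    term-recurrence : ∀ i r →
      term (suc i) (suc k ℕ.+ r) + term i r ≈ term (suc i) (k ℕ.+ r) + term (suc i) (k ℕ.+ r)
    term-recurrence i r = begin
      term (suc i) (suc k ℕ.+ r) + term i r
        ≡⟨ ≡.cong (_+ term i r) (shift-+-+ (suc k) c (coeff (suc i)) r) ⟩
      shift c (coeff (suc i)) r + shift c (coeff i) r
        ≈⟨ shift-coeff i c r ⟩
      shift (suc c) (coeff (suc i)) r + shift (suc c) (coeff (suc i)) r
        ≡⟨ ≡.cong₂ _+_ shifted shifted ⟨
      term (suc i) (k ℕ.+ r) + term (suc i) (k ℕ.+ r) ∎
      where
      c = i ℕ.* suc k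
      shifted : term (suc i) (k ℕ.+ r) ≡ shift (suc c) (coeff (suc i)) r
      shifted = ≡.trans (≡.cong (λ d → shift d (coeff (suc i)) (k ℕ.+ r)) (≡.sym (ℕₚ.+-suc k c)))
        (shift-+-+ k (suc c) (coeff (suc i)) r)

    -- T^i starts in degree i d ≥ i, so cutting the series off at m, as `a` and `b` do, loses
    -- nothing.
    term≈0 : ∀ i {m} → m < i → term i m ≈ 0#
    term≈0 i m<i = reflexive (shift-< (coeff i) (ℕₚ.<-≤-trans m<i (ℕₚ.m≤m*n i (suc k))))

    -- The coefficients of −x^d / (1 − 2x + x^d) and (1 − 2x) / (1 − 2x + x^d), where d = suc k.
    a b : ℕ → Carrier
    a m = Σ< m λ p → term (suc p) m
    b m = Σ< (suc m) λ i → term i m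

    -- Sum `term-recurrence` over i. Power i of `b` is paired with power i + 1 of `a`, and all sums
    -- are padded by zeros to the common length `N`.
    a-recurrence : ∀ r → a (suc k ℕ.+ r) + b r ≈ a (k ℕ.+ r) + a (k ℕ.+ r)
    a-recurrence r = begin
      a N + b r
        ≈⟨ +-congˡ (Σ<-extend (λ i → term i r) (s≤s (ℕₚ.m≤n+m r k)) λ i → term≈0 i) ⟩
      Σ< N (λ i → term (suc i) N) + Σ< N (λ i → term i r)
        ≈⟨ Σ<-+ N (λ i → term (suc i) N) (λ i → term i r) ⟨
      Σ< N (λ i → term (suc i) N + term i r)
        ≈⟨ Σ<-cong N (λ i _ → term-recurrence i r) ⟩
      Σ< N (λ i → term (suc i) (k ℕ.+ r) + term (suc i) (k ℕ.+ r))
        ≈⟨ Σ<-+ N (λ i → term (suc i) (k ℕ.+ r)) (λ i → term (suc i) (k ℕ.+ r)) ⟩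
      Σ< N (λ i → term (suc i) (k ℕ.+ r)) + Σ< N (λ i → term (suc i) (k ℕ.+ r))
        ≈⟨ +-cong extend extend ⟨
      a (k ℕ.+ r) + a (k ℕ.+ r) ∎
      where
      N = suc k ℕ.+ r
      extend : a (k ℕ.+ r) ≈ Σ< N λ i → term (suc i) (k ℕ.+ r)
      extend = Σ<-extend (λ i → term (suc i) (k ℕ.+ r)) (ℕₚ.n≤1+n (k ℕ.+ r))
        λ i k+r≤i → term≈0 (suc i) {k ℕ.+ r} (s≤s k+r≤i)

    a≈0 : ∀ {m} → m ≤ k → a m ≈ 0#
    a≈0 {m} m≤k = Σ<-zero m λ p _ → reflexive
      (shift-< (coeff (suc p)) (s≤s (ℕₚ.≤-trans m≤k (ℕₚ.m≤m+n k (p ℕ.* suc k)))))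

    b-suc : ∀ m → b (suc m) ≈ a (suc m)
    b-suc m = +-identityˡ _

    b≈impulse : ∀ {m} → m ≤ k → b m ≈ impulse m
    b≈impulse m≤k = trans (+-congˡ (a≈0 m≤k)) (+-identityʳ _)

    -- The leading coefficient -1 of the series, obtained from the recurrence at r = 0.
    a[1+k]+1≈0 : a (suc k) + 1# ≈ 0#
    a[1+k]+1≈0 = begin
      a (suc k) + 1#              ≡⟨ ≡.cong (λ n → a (suc n) + 1#) (ℕₚ.+-identityʳ k) ⟨
      a (suc k ℕ.+ 0) + 1#        ≈⟨ +-congˡ (b≈impulse z≤n) ⟨
      a (suc k ℕ.+ 0) + b 0       ≈⟨ a-recurrence 0 ⟩
      a (k ℕ.+ 0) + a (k ℕ.+ 0)   ≈⟨ +-cong a[k]≈0 a[k]≈0 ⟩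
      0# + 0#                     ≈⟨ +-identityˡ 0# ⟩
      0#                          ∎
      where
      a[k]≈0 : a (k ℕ.+ 0) ≈ 0#
      a[k]≈0 = a≈0 (ℕₚ.≤-reflexive (ℕₚ.+-identityʳ k))

    -- The recurrence for the summand with index j. If r < j, both indices of `a` are at most k and
    -- every term vanishes.
    a-recurrence-shift : ∀ r {j} → j ≤ k →
      a (suc (k ℕ.+ r) ∸ j) + shift j b r ≈ a (k ℕ.+ r ∸ j) + a (k ℕ.+ r ∸ j)
    a-recurrence-shift r {j} j≤k with ℕₚ.≤-<-connex j r
    ... | inj₁ j≤r with s , ≡.refl ← ℕₚ.m≤n⇒∃[o]m+o≡n j≤r = begin
      a (suc k ℕ.+ (j ℕ.+ s) ∸ j) + shift j b (j ℕ.+ s)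
        ≡⟨ ≡.cong₂ (λ n x → a n + x) (cancel (suc k)) (shift-+ j b s) ⟩
      a (suc k ℕ.+ s) + b s
        ≈⟨ a-recurrence s ⟩
      a (k ℕ.+ s) + a (k ℕ.+ s)
        ≡⟨ ≡.cong (λ n → a n + a n) (cancel k) ⟨
      a (k ℕ.+ (j ℕ.+ s) ∸ j) + a (k ℕ.+ (j ℕ.+ s) ∸ j) ∎
      where
      cancel : ∀ n → n ℕ.+ (j ℕ.+ s) ∸ j ≡ n ℕ.+ s
      cancel n = ≡.trans (ℕₚ.+-∸-assoc n (ℕₚ.m≤m+n j s)) (≡.cong (n ℕ.+_) (ℕₚ.m+n∸m≡n j s))
    ... | inj₂ r<j = begin
      a (suc (k ℕ.+ r) ∸ j) + shift j b r
        ≈⟨ +-cong (a≈0 small) (reflexive (shift-< b r<j)) ⟩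
      0# + 0#
        ≈⟨ +-cong (a≈0 small′) (a≈0 small′) ⟨
      a (k ℕ.+ r ∸ j) + a (k ℕ.+ r ∸ j) ∎
      where
      small : suc (k ℕ.+ r) ∸ j ≤ k
      small = ℕₚ.≤-trans (ℕₚ.∸-monoʳ-≤ (suc (k ℕ.+ r)) r<j)
        (ℕₚ.≤-reflexive (ℕₚ.m+n∸n≡m k r))
      small′ : k ℕ.+ r ∸ j ≤ k
      small′ = ℕₚ.≤-trans (ℕₚ.∸-monoˡ-≤ j (ℕₚ.n≤1+n (k ℕ.+ r))) small

    -- The binomial sums as coefficients of the series.

    a-closed : ∀ m →
      ∑[ 1 ≤ i ≤ m / suc k ]
        ((- 1#) ^ i * fromℕ ((m ∸ 1 ∸ i ℕ.* k) C (i ∸ 1)) * fromℕ 2 ^ (m ∸ i ℕ.* suc k)) ≈ a m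
    a-closed m = trans (Σ<-cong (m / suc k) eq)
      (Σ<-extend (λ p → term (suc p) m) (m/n≤m m (suc k)) vanish)
      where
      regroup : ∀ k p e → k ℕ.+ p ℕ.* suc k ℕ.+ e ≡ suc p ℕ.* k ℕ.+ (e ℕ.+ p)
      regroup = solve-∀
      vanish : ∀ p → m / suc k ≤ p → term (suc p) m ≈ 0#
      vanish p m/d≤p = reflexive (shift-< (coeff (suc p)) (ℕₚ.≤-<-trans
        (ℕₚ.≤-reflexive (m≡m%n+[m/n]*n m (suc k)))
        (ℕₚ.+-mono-<-≤ (m%n<n m (suc k)) (ℕₚ.*-monoˡ-≤ (suc k) m/d≤p))))
      eq : ∀ p → p < m / suc k →
        (- 1#) ^ suc p * fromℕ ((m ∸ 1 ∸ suc p ℕ.* k) C p) * fromℕ 2 ^ (m ∸ suc p ℕ.* suc k) ≈ term (suc p) m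
      -- For i = p + 1 ≤ m / d one can write m = i d + e, so the truncated subtractions are exact
      -- and the binomial becomes e + p over p.
      eq p p<m/d with e , ≡.refl ← ℕₚ.m≤n⇒∃[o]m+o≡n
        (ℕₚ.≤-trans (ℕₚ.*-monoˡ-≤ (suc k) p<m/d) (m/n*n≤m m (suc k))) = reflexive (≡.trans
          (≡.cong₂ (λ n q → (- 1#) ^ suc p * fromℕ (n C p) * fromℕ 2 ^ q) top (ℕₚ.m+n∸m≡n (suc p ℕ.* suc k) e))
          (≡.sym (shift-+ (suc p ℕ.* suc k) (coeff (suc p)) e)))
        where
        top : k ℕ.+ p ℕ.* suc k ℕ.+ e ∸ suc p ℕ.* k ≡ e ℕ.+ p
        top = ≡.trans (≡.cong (_∸ suc p ℕ.* k) (regroup k p e)) (ℕₚ.m+n∸m≡n (suc p ℕ.* k) (e ℕ.+ p))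

    -- Comparison of F with the closed form.

    module _ (F : ℕ → Carrier)
      (F-rec : ∀ n → k ≤ n → F n ≈ ∑[ 1 ≤ i ≤ k ] F (n ∸ i)) where

      -- Both sides sum the k + 1 consecutive values from F r to F (k + r): on the left the lowest
      -- is split off, on the right the highest.
      F-recurrence : ∀ r → F (suc (k ℕ.+ r)) + F r ≈ F (k ℕ.+ r) + F (k ℕ.+ r)
      F-recurrence r = begin
        F (suc (k ℕ.+ r)) + F r
          ≈⟨ +-cong (F-rec (suc (k ℕ.+ r)) (ℕₚ.m≤n⇒m≤1+n (ℕₚ.m≤m+n k r)))
                    (reflexive (≡.cong F (≡.sym (ℕₚ.m+n∸m≡n k r)))) ⟩
        Σ< k (λ i → F (k ℕ.+ r ∸ i)) + F (k ℕ.+ r ∸ k)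
          ≈⟨ Σ<-suc k (λ i → F (k ℕ.+ r ∸ i)) ⟨
        F (k ℕ.+ r) + Σ< k (λ i → F (k ℕ.+ r ∸ suc i))
          ≈⟨ +-congˡ (F-rec (k ℕ.+ r) (ℕₚ.m≤m+n k r)) ⟨
        F (k ℕ.+ r) + F (k ℕ.+ r) ∎

      -- The linear shape of the right-hand side of the formula, through which recurrences of
      -- coefficients pass to `G`.
      combine : Carrier → (ℕ → Carrier) → Carrier
      combine x f = - F k * x + Σ< k λ j → F j * f j

      combine-cong : ∀ {x y f g} → x ≈ y → (∀ j → j < k → f j ≈ g j) → combine x f ≈ combine y g
      combine-cong x≈y f≈g = +-cong (*-congˡ x≈y) (Σ<-cong k λ j j<k → *-congˡ {F j} (f≈g j j<k))

      combine-+ : ∀ x y f g → combine (x + y) (λ j → f j + g j) ≈ combine x f + combine y g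
      combine-+ x y f g = begin
        - F k * (x + y) + Σ< k (λ j → F j * (f j + g j))
          ≈⟨ +-cong (distribˡ _ x y)
               (trans (Σ<-cong k λ j _ → distribˡ (F j) (f j) (g j)) (Σ<-+ k (λ j → F j * f j) (λ j → F j * g j))) ⟩
        (- F k * x + - F k * y) + (Σ< k (λ j → F j * f j) + Σ< k (λ j → F j * g j))
          ≈⟨ solve 4 (λ p q r s → (p :+ q) :+ (r :+ s) := (p :+ r) :+ (q :+ s)) refl _ _ _ _ ⟩
        combine x f + combine y g ∎

      G : ℕ → Carrier
      G n = combine (a (suc n)) λ j → a (n ∸ j)

      -- The lagging term in the recurrence of `G`. Having `b` in place of `a` adds F j in position
      -- j, so `H` takes the initial values of F below k and agrees with `G` from k on.
      H : ℕ → Carrier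
      H r = combine (a (suc r)) λ j → shift j b r

      G-recurrence : ∀ r → G (suc (k ℕ.+ r)) + H r ≈ G (k ℕ.+ r) + G (k ℕ.+ r)
      G-recurrence r = begin
        G (suc (k ℕ.+ r)) + H r
          ≈⟨ combine-+ _ _ (λ j → a (suc (k ℕ.+ r) ∸ j)) (λ j → shift j b r) ⟨
        combine (a (suc (suc (k ℕ.+ r))) + a (suc r)) (λ j → a (suc (k ℕ.+ r) ∸ j) + shift j b r)
          ≈⟨ combine-cong first (λ j j<k → a-recurrence-shift r (ℕₚ.<⇒≤ j<k)) ⟩
        combine (a (suc (k ℕ.+ r)) + a (suc (k ℕ.+ r))) (λ j → a (k ℕ.+ r ∸ j) + a (k ℕ.+ r ∸ j))
          ≈⟨ combine-+ _ _ (λ j → a (k ℕ.+ r ∸ j)) (λ j → a (k ℕ.+ r ∸ j)) ⟩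
        G (k ℕ.+ r) + G (k ℕ.+ r) ∎
        where
        first : a (suc (suc (k ℕ.+ r))) + a (suc r) ≈ a (suc (k ℕ.+ r)) + a (suc (k ℕ.+ r))
        first = begin
          a (suc (suc (k ℕ.+ r))) + a (suc r)
            ≈⟨ +-cong (reflexive (≡.cong (λ n → a (suc n)) (≡.sym (ℕₚ.+-suc k r)))) (sym (b-suc r)) ⟩
          a (suc k ℕ.+ suc r) + b (suc r)
            ≈⟨ a-recurrence (suc r) ⟩
          a (k ℕ.+ suc r) + a (k ℕ.+ suc r)
            ≡⟨ ≡.cong (λ n → a n + a n) (ℕₚ.+-suc k r) ⟩
          a (suc (k ℕ.+ r)) + a (suc (k ℕ.+ r)) ∎

      H-below : ∀ {r} → r < k → H r ≈ F r
      H-below {r} r<k = begin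
        H r
          ≈⟨ combine-cong (a≈0 r<k) (λ j _ → shift-cong j r λ i i≤r →
               b≈impulse (ℕₚ.≤-trans i≤r (ℕₚ.<⇒≤ r<k))) ⟩
        - F k * 0# + Σ< k (λ j → F j * shift j impulse r)
          ≈⟨ +-cong (zeroʳ _) (Σ<-impulse F r<k) ⟩
        0# + F r
          ≈⟨ +-identityˡ _ ⟩
        F r ∎

      H-above : ∀ {n} → k ≤ n → H n ≈ G n
      H-above {n} k≤n = combine-cong refl λ j j<k → unshift (ℕₚ.<-≤-trans j<k k≤n)
        where
        unshift : ∀ {j n} → j < n → shift j b n ≈ a (n ∸ j)
        unshift {zero}  {suc n} _         = b-suc n
        unshift {suc j} {suc n} (s≤s j<n) = unshift j<n

      -- Every a (k - j) vanishes, and a (k + 1) = -1 turns the first summand into F k.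
      F≈G-base : F k ≈ G k
      F≈G-base = sym (+-cancelʳ (- F k) (G k) (F k) (begin
        G k + - F k
          ≈⟨ +-congʳ (+-congˡ (Σ<-zero k λ j _ → trans (*-congˡ (a≈0 (ℕₚ.m∸n≤m k j))) (zeroʳ (F j)))) ⟩
        - F k * a (suc k) + 0# + - F k
          ≈⟨ solve 2 (λ x y → x :* y :+ con 0 :+ x := x :* (y :+ con 1)) refl (- F k) (a (suc k)) ⟩
        - F k * (a (suc k) + 1#)
          ≈⟨ *-congˡ a[1+k]+1≈0 ⟩
        - F k * 0#
          ≈⟨ zeroʳ _ ⟩
        0#
          ≈⟨ -‿inverseʳ (F k) ⟨
        F k + - F k ∎))

      -- Strong induction, made structural by the bound `B`: the value at k + r + 1 depends on those
      -- at k + r and at r, and the latter needs the induction hypothesis once r ≥ k.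
      F≈G-bounded : ∀ B r → r ≤ B → F (k ℕ.+ r) ≈ G (k ℕ.+ r)
      F≈G-bounded B zero _ = ≡.subst (λ n → F n ≈ G n) (≡.sym (ℕₚ.+-identityʳ k)) F≈G-base
      F≈G-bounded (suc B) (suc r) (s≤s r≤B) =
        ≡.subst (λ n → F n ≈ G n) (≡.sym (ℕₚ.+-suc k r))
          (+-cancelʳ (F r) (F (suc (k ℕ.+ r))) (G (suc (k ℕ.+ r))) (begin
            F (suc (k ℕ.+ r)) + F r        ≈⟨ F-recurrence r ⟩
            F (k ℕ.+ r) + F (k ℕ.+ r)      ≈⟨ +-cong ih ih ⟩
            G (k ℕ.+ r) + G (k ℕ.+ r)      ≈⟨ G-recurrence r ⟨
            G (suc (k ℕ.+ r)) + H r        ≈⟨ +-congˡ H≈F ⟩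
            G (suc (k ℕ.+ r)) + F r        ∎))
        where
        ih : F (k ℕ.+ r) ≈ G (k ℕ.+ r)
        ih = F≈G-bounded B r r≤B
        H≈F : H r ≈ F r
        H≈F with ℕₚ.<-≤-connex r k
        ... | inj₁ r<k = H-below r<k
        ... | inj₂ k≤r with s , ≡.refl ← ℕₚ.m≤n⇒∃[o]m+o≡n k≤r =
          trans (H-above k≤r) (sym (F≈G-bounded B s (ℕₚ.≤-trans (ℕₚ.m≤n+m s k) r≤B)))

      F≈G : ∀ {n} → k ≤ n → F n ≈ G n
      F≈G k≤n with r , ≡.refl ← ℕₚ.m≤n⇒∃[o]m+o≡n k≤n = F≈G-bounded r r ℕₚ.≤-refl

      formula : ∀ n → k ≤ n →
        F n ≈
          - F k * (∑[ 1 ≤ i ≤ (n ℕ.+ 1) / suc k ]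
              (- 1#) ^ i * fromℕ ((n ∸ i ℕ.* k) C (i ∸ 1)) * fromℕ 2 ^ (n ℕ.+ 1 ∸ i ℕ.* suc k))
          + Σ< k (λ j → ∑[ 1 ≤ i ≤ (n ∸ j) / suc k ]
              (- 1#) ^ i * F j * fromℕ ((n ∸ j ∸ 1 ∸ i ℕ.* k) C (i ∸ 1)) * fromℕ 2 ^ (n ∸ j ∸ i ℕ.* suc k))
      formula n k≤n = trans (F≈G k≤n)
        (+-cong (*-congˡ (sym first)) (Σ<-cong k λ j _ → sym (second j)))
        where
        first : ∑[ 1 ≤ i ≤ (n ℕ.+ 1) / suc k ]
          ((- 1#) ^ i * fromℕ ((n ∸ i ℕ.* k) C (i ∸ 1)) * fromℕ 2 ^ (n ℕ.+ 1 ∸ i ℕ.* suc k)) ≈ a (suc n)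
        first rewrite ℕₚ.+-comm n 1 = a-closed (suc n)
        second : ∀ j → ∑[ 1 ≤ i ≤ (n ∸ j) / suc k ]
          ((- 1#) ^ i * F j * fromℕ ((n ∸ j ∸ 1 ∸ i ℕ.* k) C (i ∸ 1)) * fromℕ 2 ^ (n ∸ j ∸ i ℕ.* suc k))
          ≈ F j * a (n ∸ j)
        second j = begin
          ∑[ 1 ≤ i ≤ (n ∸ j) / suc k ]
            ((- 1#) ^ i * F j * fromℕ ((n ∸ j ∸ 1 ∸ i ℕ.* k) C (i ∸ 1)) * fromℕ 2 ^ (n ∸ j ∸ i ℕ.* suc k))
            ≈⟨ Σ<-cong ((n ∸ j) / suc k) (λ p _ →
                 solve 4 (λ s x c q → s :* x :* c :* q := x :* (s :* c :* q)) refl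
                   ((- 1#) ^ suc p) (F j) (fromℕ ((n ∸ j ∸ 1 ∸ suc p ℕ.* k) C p))
                   (fromℕ 2 ^ (n ∸ j ∸ suc p ℕ.* suc k))) ⟩
          ∑[ 1 ≤ i ≤ (n ∸ j) / suc k ]
            (F j * ((- 1#) ^ i * fromℕ ((n ∸ j ∸ 1 ∸ i ℕ.* k) C (i ∸ 1)) * fromℕ 2 ^ (n ∸ j ∸ i ℕ.* suc k)))
            ≈⟨ *-distribˡ-sum {(n ∸ j) / suc k} (F j) _ ⟨
          F j * (∑[ 1 ≤ i ≤ (n ∸ j) / suc k ]
            ((- 1#) ^ i * fromℕ ((n ∸ j ∸ 1 ∸ i ℕ.* k) C (i ∸ 1)) * fromℕ 2 ^ (n ∸ j ∸ i ℕ.* suc k)))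
            ≈⟨ *-congˡ (a-closed (n ∸ j)) ⟩
          F j * a (n ∸ j) ∎

-- Specialization to the complex numbers.

open CommutativeRing ℂ-commutativeRing using (_≈_; _+_; _*_; -_; 1#)
open RingNotation ℂ-commutativeRing using (fromℕ; _^_; ∑-syntax)

theorem4 : (k : ℕ) → 2 ≤ k →
    (F : ℕ → ℂ) →
    (∀ n → k ≤ n → F n ≈ ∑[ 1 ≤ i ≤ k ] F (n ∸ i)) →
    ∀ n → k ≤ n →
    F n ≈
      - F k * (∑[ 1 ≤ i ≤ (n ℕ.+ 1) / suc k ]
          (- 1#) ^ i * fromℕ ((n ∸ i ℕ.* k) C (i ∸ 1)) * fromℕ 2 ^ (n ℕ.+ 1 ∸ i ℕ.* suc k))
      + (∑[ 0 ≤ j ≤ k ∸ 1 ] ∑[ 1 ≤ i ≤ (n ∸ j) / suc k ]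
          (- 1#) ^ i * F j * fromℕ ((n ∸ j ∸ 1 ∸ i ℕ.* k) C (i ∸ 1)) * fromℕ 2 ^ (n ∸ j ∸ i ℕ.* suc k))
-- With k a successor, the range 0 ≤ j ≤ k - 1 has k terms by computation, which identifies the
-- outer sum with `Σ<`.
theorem4 (suc k) _ = formula ℂ-commutativeRing (suc k)
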